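{- For each integer $r\ge 3$ let $f_{r,1}(x)=1+x+x^{2^r-1}+x^{2^r+1}\in\mathbb{F}_2[x]$. Then for every $r\geq 3$ the polynomial $f_{r,1}$ is robust and its order divides $4^r-1$; moreover $\displaystyle\lim_{r\to\infty}\gamma(f_{r,1})=1$.
   Context: For $f\in\mathbb{F}_2[x]$ with $f(0)=1$ and $\deg f\ge 1$, the order $\operatorname{ord}(f)$ is the least integer $D\ge 1$ such that $f(x)\mid 1+x^D$ in $\mathbb{F}_2[x]$. With $D=\operatorname{ord}(f)$, let $f^*(x)\in\mathbb{F}_2[x]$ be defined by $f(x)f^*(x)=1+x^D$. For $g\in\mathbb{F}_2[x]$, $\ell_1(g)$ is the number of monomials of $g$ (terms with coefficient $1$), and for $N\ge\deg g$, $\ell_{0,N}(g)$ is the number of exponents $k\in\{0,1,\dots,N\}$ for which the coefficient of $x^k$ in $g$ is $0$. Define $\gamma(f)=\ell_1(f^*)/D$. The polynomial $f$ is called robust if $\ell_1(f^*)>\ell_{0,D-1}(f^*)+1$, equivalently $\ell_1(f^*)>(D+1)/2$. -}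

module Defs where

open import Data.Integer.Base using (+_)
open import Data.List.Base using (List; []; _∷_; filter; length; map; replicate; upTo; _++_)
open import Data.Nat.Base as ℕ using (ℕ; zero; suc; _≤_; _∸_; _^_; >-nonZero)
open import Data.Parity.Base using (Parity; 0ℙ; 1ℙ; _+_; _*_)
open import Data.Parity.Properties using (_≟_)
open import Data.Product.Base using (Σ-syntax; ∃-syntax; _×_)
open import Data.Rational.Base as ℚ using (ℚ; 0ℚ)
open import Relation.Binary.PropositionalEquality using (_≡_)

-- 𝔽₂ is the library's `Parity` (with its `_+_`, `_*_`).  A polynomial over 𝔽₂
-- is a list of coefficients, constant term first; trailing zeros are allowed,
-- so equality of polynomials is `_≈_`, not `_≡_`.

Poly : Set
Poly = List Parity

coeff : Poly → ℕ → Parity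
coeff []      _       = 0ℙ
coeff (a ∷ _) zero    = a
coeff (_ ∷ p) (suc k) = coeff p k

infix 4 _≈_ _∣ₚ_
infixl 6 _⊕_
infixl 7 _⊗_

_≈_ : Poly → Poly → Set
p ≈ q = ∀ k → coeff p k ≡ coeff q k

_⊕_ : Poly → Poly → Poly
[]      ⊕ q       = q
p@(_ ∷ _) ⊕ []    = p
(a ∷ p) ⊕ (b ∷ q) = (a + b) ∷ (p ⊕ q)

_⊗_ : Poly → Poly → Poly
[]      ⊗ q = []
(a ∷ p) ⊗ q = map (a *_) q ⊕ (0ℙ ∷ (p ⊗ q))

x^_ : ℕ → Poly
x^ n = replicate n 0ℙ ++ (1ℙ ∷ [])

1ₚ : Poly
1ₚ = x^ 0

_∣ₚ_ : Poly → Poly → Set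
f ∣ₚ g = ∃[ h ] (f ⊗ h ≈ g)

ℓ₁ : Poly → ℕ
ℓ₁ g = length (filter (_≟ 1ℙ) g)

-- Number of zero coefficients among the exponents 0, 1, …, N.
ℓ₀ : ℕ → Poly → ℕ
ℓ₀ N g = length (filter (λ k → coeff g k ≟ 0ℙ) (upTo (suc N)))

-- `IsOrder f D` says that ord(f) is defined and equal to D.  A relation is used
-- instead of a function ord, so asserting `∃[ D ] IsOrder f D × …` includes the
-- claim that the order exists; D is unique by minimality.
record IsOrder (f : Poly) (D : ℕ) : Set where
  field
    f[0]≡1  : coeff f 0 ≡ 1ℙ
    deg≥1   : ∃[ k ] (1 ≤ k × coeff f k ≡ 1ℙ)
    D≥1     : 1 ≤ D
    divides : f ∣ₚ 1ₚ ⊕ x^ D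
    least   : ∀ E → 1 ≤ E → f ∣ₚ 1ₚ ⊕ x^ E → D ≤ E

-- The pair (ord f , f*).  It is determined by f (the second component up to _≈_,
-- which ℓ₁ and ℓ₀ respect), so the existential quantifications over it in
-- `Robust` and `IsGamma` only name these two objects.
record Dual (f : Poly) : Set where
  field
    ord     : ℕ
    isOrder : IsOrder f ord
    f*      : Poly
    f⊗f*    : f ⊗ f* ≈ 1ₚ ⊕ x^ ord

  γ : ℚ
  γ = (+ ℓ₁ f* ℚ./ ord) {{>-nonZero (IsOrder.D≥1 isOrder)}}

Robust : Poly → Set
Robust f = Σ[ d ∈ Dual f ] (let open Dual d in ℓ₀ (ord ∸ 1) f* ℕ.+ 1 ℕ.< ℓ₁ f*)

IsGamma : Poly → ℚ → Set
IsGamma f q = Σ[ d ∈ Dual f ] (q ≡ Dual.γ d)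

infix 4 _⟶_

_⟶_ : (ℕ → ℚ) → ℚ → Set
s ⟶ L = ∀ ε → 0ℚ ℚ.< ε → ∃[ N ] (∀ n → N ≤ n → ℚ.∣ s n ℚ.- L ∣ ℚ.< ε)

f₁ : ℕ → Poly
f₁ r = 1ₚ ⊕ x^ 1 ⊕ x^ (2 ^ r ∸ 1) ⊕ x^ (2 ^ r ℕ.+ 1)

{-# OPTIONS --safe #-}
module Submission where

-- Write q = 2^r and N = q² − 1.  Then f = (1 + x)(1 + x^(q−1) + x^q), and a
-- telescoping sum gives f·H = 1 + x^N for
--   H = Σ_{j<q−1} x^(jq) · ((1 + x + … + x^(q−1)) + x^(q−1−j) (1 + x)^j),
-- where the j-th summand only involves the exponents jq, …, jq + q − 1.  The first q rows
-- of Pascal's triangle mod 2 contain 3^r ones, so H has q² − 3^r = 4^r − 3^r monomials.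
-- Since f ∣ 1 + x^E exactly when the power series 1/f has period E, the order D divides N
-- and H consists of m = N/D copies of f*.  Hence γ(f) = (4^r − 3^r)/(4^r − 1); for
-- robustness it suffices that m < 2^r, which follows from D ≥ deg f = q + 1.

open import Defs
open import Algebra.Solver.Ring.AlmostCommutativeRing using (fromCommutativeRing)
import Algebra.Solver.Ring.Simple as RingSolver
open import Data.Integer.Base as ℤ using (+[1+_]; -[1+_]; +<+) renaming (+_ to pos)
import Data.Integer.Properties as ℤ
open import Data.List.Base using (List; []; _∷_; map; applyUpTo; length; filter)
open import Data.Nat.Base
open import Data.Nat.Divisibility using (_∣_; m%n≡0⇒n∣m; divides)
open import Data.Nat.DivMod
open import Data.Nat.Induction using (<-rec)
open import Data.Nat.Properties
open import Data.Nat.Tactic.RingSolver using (solve-∀)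
open import Data.Parity.Base as ℙ using (Parity; 0ℙ; 1ℙ)
import Data.Parity.Properties as ℙ
open import Data.Product.Base using (Σ-syntax; ∃-syntax; _×_; _,_; proj₂)
open import Data.Rational.Base as ℚ using (ℚ; 0ℚ; 1ℚ; mkℚ; toℚᵘ)
import Data.Rational.Properties as ℚ
open import Data.Rational.Unnormalised.Base as ℚᵘ using (mkℚᵘ; 1ℚᵘ)
import Data.Rational.Unnormalised.Properties as ℚᵘ
open import Function.Base using (_∘_; id)
open import Level using (0ℓ)
open import Relation.Binary.PropositionalEquality
open import Relation.Nullary using (yes; no; contradiction)
open import Relation.Nullary.Decidable using (map′; _×-dec_)
open import Relation.Unary using (Pred; Decidable)

open RingSolver (fromCommutativeRing ℙ.+-*-commutativeRing) ℙ._≟_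
  using (solve; _:+_; _:=_; con)

-- Sequences over 𝔽₂ as power series

-- `H` is a truncated partial fraction expansion of 1/f. Put G = 1 + x^(q-1) (1 + x), so that f = (1
-- + x) G. In characteristic 2 this gives 1/f = 1/(1 + x) + x^(q-1)/G, and 1/G is the geometric
-- series in x^(q-1) (1 + x). The j-th summand of `H` collects x^(jq) (1 + ... + x^(q-1)) from the
-- first fraction and x^(q-1) (x^(q-1) (1 + x))^j from the second. Stopping after q - 1 summands
-- leaves a remainder containing (1 + x)^q, and here it matters that q is a power of 2.
--
-- The exact value of D is never determined. All counts are therefore made over q² - 1 consecutive
-- coefficients of 1/f, where ratios such as γ do not depend on the number m of copies. Robustness
-- is not a pure ratio: its summand 1 becomes m after scaling, hence the bound on m.
--
-- Functions from ℕ to 𝔽₂ make 1/f an object of the same kind as the polynomials and remove the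
-- ambiguity of trailing zeros; a degree bound becomes vanishing from some exponent on.

Seq : Set
Seq = ℕ → Parity

infixl 6 _⊞_

_⊞_ : Seq → Seq → Seq
(a ⊞ b) n = a n ℙ.+ b n

𝟘 : Seq
𝟘 _ = 0ℙ

δ : Seq
δ zero    = 1ℙ
δ (suc _) = 0ℙ

shift : ℕ → Seq → Seq
shift zero    a n       = a n
shift (suc m) a zero    = 0ℙ
shift (suc m) a (suc n) = shift m a n

shift-cong : ∀ m {a b} → a ≗ b → shift m a ≗ shift m b
shift-cong zero    eq n       = eq n
shift-cong (suc m) eq zero    = refl
shift-cong (suc m) eq (suc n) = shift-cong m eq n

shift-⊞ : ∀ m a b → shift m (a ⊞ b) ≗ shift m a ⊞ shift m b
shift-⊞ zero    a b n       = refl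
shift-⊞ (suc m) a b zero    = refl
shift-⊞ (suc m) a b (suc n) = shift-⊞ m a b n

shift-𝟘 : ∀ m → shift m 𝟘 ≗ 𝟘
shift-𝟘 zero    n       = refl
shift-𝟘 (suc m) zero    = refl
shift-𝟘 (suc m) (suc n) = shift-𝟘 m n

shift-shift : ∀ m n a → shift m (shift n a) ≗ shift (m + n) a
shift-shift zero    n a k       = refl
shift-shift (suc m) n a zero    = refl
shift-shift (suc m) n a (suc k) = shift-shift m n a k

shift-comm : ∀ m n a → shift m (shift n a) ≗ shift n (shift m a)
shift-comm m n a k = begin
  shift m (shift n a) k ≡⟨ shift-shift m n a k ⟩
  shift (m + n) a k     ≡⟨ cong (λ l → shift l a k) (+-comm m n) ⟩
  shift (n + m) a k     ≡⟨ shift-shift n m a k ⟨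
  shift n (shift m a) k ∎
  where open ≡-Reasoning

shift-< : ∀ {m n} a → n < m → shift m a n ≡ 0ℙ
shift-< {suc m} {zero}  a _         = refl
shift-< {suc m} {suc n} a (s≤s n<m) = shift-< a n<m

shift-+ : ∀ m a n → shift m a (m + n) ≡ a n
shift-+ zero    a n = refl
shift-+ (suc m) a n = shift-+ m a n

-- Multiplication by the sum of the monomials x^m over the listed exponents m.
mul : List ℕ → Seq → Seq
mul []       a = 𝟘
mul (m ∷ ms) a = shift m a ⊞ mul ms a

mul-cong : ∀ ms {a b} → a ≗ b → mul ms a ≗ mul ms b
mul-cong []       eq n = refl
mul-cong (m ∷ ms) eq n = cong₂ ℙ._+_ (shift-cong m eq n) (mul-cong ms eq n)

mul-𝟘 : ∀ ms → mul ms 𝟘 ≗ 𝟘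
mul-𝟘 []       n = refl
mul-𝟘 (m ∷ ms) n = cong₂ ℙ._+_ (shift-𝟘 m n) (mul-𝟘 ms n)

mul-⊞ : ∀ ms a b → mul ms (a ⊞ b) ≗ mul ms a ⊞ mul ms b
mul-⊞ []       a b n = refl
mul-⊞ (m ∷ ms) a b n rewrite shift-⊞ m a b n | mul-⊞ ms a b n =
  solve 4 (λ u v w z → (u :+ v) :+ (w :+ z) := (u :+ w) :+ (v :+ z)) refl
    (shift m a n) (shift m b n) (mul ms a n) (mul ms b n)

mul-shift : ∀ ms m a → mul ms (shift m a) ≗ shift m (mul ms a)
mul-shift []       m a n = sym (shift-𝟘 m n)
mul-shift (l ∷ ms) m a n = begin
  shift l (shift m a) n ℙ.+ mul ms (shift m a) n
    ≡⟨ cong₂ ℙ._+_ (shift-comm l m a n) (mul-shift ms m a n) ⟩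
  shift m (shift l a) n ℙ.+ shift m (mul ms a) n
    ≡⟨ shift-⊞ m (shift l a) (mul ms a) n ⟨
  shift m (shift l a ⊞ mul ms a) n ∎
  where open ≡-Reasoning

ones : ℕ → Seq
ones zero    = 𝟘
ones (suc n) = δ ⊞ shift 1 (ones n)

-- The coefficients of (1 + x)^j.
pascal : ℕ → Seq
pascal zero    = δ
pascal (suc j) = pascal j ⊞ shift 1 (pascal j)

ones-telescope : ∀ m → ones m ⊞ shift 1 (ones m) ≗ δ ⊞ shift m δ
ones-telescope zero    zero    = refl
ones-telescope zero    (suc n) = refl
ones-telescope (suc m) zero    = refl
ones-telescope (suc m) (suc n) = begin
  ones m n ℙ.+ (δ n ℙ.+ shift 1 (ones m) n)
    ≡⟨ solve 3 (λ u v w → u :+ (v :+ w) := v :+ (u :+ w)) refl (ones m n) (δ n) (shift 1 (ones m) n) ⟩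
  δ n ℙ.+ (ones m n ℙ.+ shift 1 (ones m) n)
    ≡⟨ cong (δ n ℙ.+_) (ones-telescope m n) ⟩
  δ n ℙ.+ (δ n ℙ.+ shift m δ n)
    ≡⟨ solve 2 (λ u v → u :+ (u :+ v) := v) refl (δ n) (shift m δ n) ⟩
  shift m δ n ∎
  where open ≡-Reasoning

-- The polynomial H; throughout q = 2 + p, so that q − 1 and q − 2 need no subtraction.

module _ (p : ℕ) where

  private
    q = 2 + p

  F-exponents G-exponents : List ℕ
  F-exponents = 0 ∷ 1 ∷ 1 + p ∷ 3 + p ∷ []
  G-exponents = 0 ∷ 1 + p ∷ 2 + p ∷ []

  -- Multiplication by f and by f / (1 + x).
  F G : Seq → Seq
  F = mul F-exponents
  G = mul G-exponents

  F-factor : ∀ a → F a ≗ G (a ⊞ shift 1 a)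
  F-factor a n
    rewrite shift-⊞ (1 + p) a (shift 1 a) n | shift-⊞ (2 + p) a (shift 1 a) n
          | shift-shift (1 + p) 1 a n | shift-shift (2 + p) 1 a n | +-comm p 1 =
    solve 5 (λ t u v w z → t :+ (u :+ (v :+ (z :+ con 0ℙ)))
                        := (t :+ u) :+ ((v :+ w) :+ ((w :+ z) :+ con 0ℙ)))
      refl (a n) (shift 1 a n) (shift (1 + p) a n) (shift (2 + p) a n) (shift (3 + p) a n)

  block : ℕ → Seq
  block j = ones q ⊞ shift (1 + p ∸ j) (pascal j)

  H : ℕ → Seq
  H zero    = 𝟘
  H (suc j) = H j ⊞ shift (j * q) (block j)

  -- The factor 1 + x closes `ones q` to 1 + x^q and turns row j of Pascal's triangle into row 1 +
  -- j. The remaining factor is 1 + x^(q-1) (1 + x), which reproduces row 1 + j and adds row 2 + j,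
  -- moved up by q - 1.
  F-block : ∀ j → j ≤ p →
    F (block j) ≗ G δ ⊞ shift q (G δ) ⊞ shift (1 + p ∸ j) (pascal (1 + j))
                      ⊞ shift (q + (p ∸ j)) (pascal (2 + j))
  F-block j j≤p n rewrite +-∸-assoc 1 j≤p = begin
    F (ones q ⊞ shift (suc k) (pascal j)) n
      ≡⟨ F-factor (ones q ⊞ shift (suc k) (pascal j)) n ⟩
    G (ones q ⊞ shift (suc k) (pascal j) ⊞ shift 1 (ones q ⊞ shift (suc k) (pascal j))) n
      ≡⟨ mul-cong G-exponents times1+x n ⟩
    G (δ ⊞ shift q δ ⊞ shift (suc k) a) n
      ≡⟨ mul-⊞ G-exponents (δ ⊞ shift q δ) _ n ⟩
    (G (δ ⊞ shift q δ) ⊞ G (shift (suc k) a)) n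
      ≡⟨ cong₂ ℙ._+_ (mul-⊞ G-exponents δ (shift q δ) n) (mul-shift G-exponents (suc k) a n) ⟩
    G δ n ℙ.+ G (shift q δ) n ℙ.+ shift (suc k) (G a) n
      ≡⟨ cong₂ (λ u v → G δ n ℙ.+ u ℙ.+ v) (mul-shift G-exponents q δ n) shifted ⟩
    G δ n ℙ.+ shift q (G δ) n ℙ.+ (shift (suc k) a n ℙ.+ shift (q + k) (a ⊞ shift 1 a) n)
      ≡⟨ ℙ.+-assoc (G δ n ℙ.+ shift q (G δ) n) _ _ ⟨
    G δ n ℙ.+ shift q (G δ) n ℙ.+ shift (suc k) a n ℙ.+ shift (q + k) (a ⊞ shift 1 a) n ∎
    where
    open ≡-Reasoning
    k = p ∸ j
    a = pascal (1 + j)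

    times1+x : ones q ⊞ shift (suc k) (pascal j) ⊞ shift 1 (ones q ⊞ shift (suc k) (pascal j))
             ≗ δ ⊞ shift q δ ⊞ shift (suc k) a
    times1+x i
      rewrite shift-⊞ 1 (ones q) (shift (suc k) (pascal j)) i
            | shift-⊞ (suc k) (pascal j) (shift 1 (pascal j)) i
            | shift-comm 1 (suc k) (pascal j) i
            | sym (ones-telescope q i) =
      solve 4 (λ u v w z → (u :+ v) :+ (w :+ z) := (u :+ w) :+ (v :+ z)) refl
        (ones q i) (shift (suc k) (pascal j) i) (shift 1 (ones q) i)
        (shift (suc k) (shift 1 (pascal j)) i)

    shifted : shift (suc k) (G a) n ≡ shift (suc k) a n ℙ.+ shift (q + k) (a ⊞ shift 1 a) n
    shifted
      rewrite shift-⊞ (suc k) a (shift (1 + p) a ⊞ (shift q a ⊞ 𝟘)) n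
            | shift-⊞ (suc k) (shift (1 + p) a) (shift q a ⊞ 𝟘) n
            | shift-⊞ (suc k) (shift q a) 𝟘 n
            | shift-𝟘 (suc k) n
            | shift-shift (suc k) (1 + p) a n
            | shift-shift (suc k) q a n
            | shift-⊞ (q + k) a (shift 1 a) n
            | shift-shift (q + k) 1 a n
            | +-comm (p + k) 1 | +-suc k (suc p) | +-suc k p | +-comm k p =
      cong (shift (suc k) a n ℙ.+_)
        (cong (shift (q + k) a n ℙ.+_) (ℙ.+-identityʳ _))

  -- The pascal (1 + j) term of F (block j) cancels the one left over by the previous blocks.
  F-H : ∀ j → j ≤ 1 + p →
    F (H j) ≗ G δ ⊞ shift (j * q) (G δ) ⊞ shift (1 + p) (pascal 1)
                  ⊞ shift (j * q + (1 + p ∸ j)) (pascal (1 + j))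
  -- At j = 0 the four terms on the right form two equal pairs, which cancel in characteristic 2.
  F-H zero j≤ n rewrite mul-𝟘 F-exponents n =
    solve 2 (λ u v → con 0ℙ := u :+ u :+ v :+ v) refl (G δ n) (shift (1 + p) (pascal 1) n)
  F-H (suc j) (s≤s j≤p) n = begin
    F (H j ⊞ shift (j * q) (block j)) n
      ≡⟨ mul-⊞ F-exponents (H j) (shift (j * q) (block j)) n ⟩
    F (H j) n ℙ.+ F (shift (j * q) (block j)) n
      ≡⟨ cong₂ ℙ._+_ (F-H j (m≤n⇒m≤1+n j≤p) n)
           (trans (mul-shift F-exponents (j * q) (block j) n)
             (trans (shift-cong (j * q) (F-block j j≤p) n) expand)) ⟩
    (A ℙ.+ B ℙ.+ C ℙ.+ D) ℙ.+ (B ℙ.+ B′ ℙ.+ D ℙ.+ D′)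
      ≡⟨ solve 6 (λ a b c d b′ d′ → (a :+ b :+ c :+ d) :+ (b :+ b′ :+ d :+ d′)
                                  := a :+ b′ :+ c :+ d′) refl A B C D B′ D′ ⟩
    A ℙ.+ B′ ℙ.+ C ℙ.+ D′ ∎
    where
    open ≡-Reasoning
    k = p ∸ j
    A = G δ n
    B = shift (j * q) (G δ) n
    C = shift (1 + p) (pascal 1) n
    D = shift (j * q + (1 + p ∸ j)) (pascal (1 + j)) n
    B′ = shift (suc j * q) (G δ) n
    D′ = shift (suc j * q + k) (pascal (2 + j)) n

    expand : shift (j * q) (G δ ⊞ shift q (G δ) ⊞ shift (1 + p ∸ j) (pascal (1 + j))
                      ⊞ shift (q + (p ∸ j)) (pascal (2 + j))) n
             ≡ B ℙ.+ B′ ℙ.+ D ℙ.+ D′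
    expand
      rewrite shift-⊞ (j * q) (G δ ⊞ shift q (G δ) ⊞ shift (1 + p ∸ j) (pascal (1 + j)))
                        (shift (q + k) (pascal (2 + j))) n
            | shift-⊞ (j * q) (G δ ⊞ shift q (G δ)) (shift (1 + p ∸ j) (pascal (1 + j))) n
            | shift-⊞ (j * q) (G δ) (shift q (G δ)) n
            | shift-shift (j * q) q (G δ) n
            | shift-shift (j * q) (1 + p ∸ j) (pascal (1 + j)) n
            | shift-shift (j * q) (q + k) (pascal (2 + j)) n
            | sym (+-assoc (j * q) q k)
            | +-comm (j * q) q = refl

  -- This is q² - 1, written as the exponent arises when the term x^(q-1) of `G δ` is shifted by (q
  -- - 1) q.
  period : ℕ
  period = (1 + p) * q + (1 + p)

  -- Once (1 + x)^q is replaced by 1 + x^q, the four terms of `F-H` collapse in pairs: G + x^(q-1)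
  -- (1 + x) = 1, and G + 1 + x^q = x^(q-1), the latter multiplied by x^((q-1) q).
  F-H-last : pascal q ≗ δ ⊞ shift q δ → F (H (1 + p)) ≗ δ ⊞ shift period δ
  F-H-last freshman n = begin
    F (H (1 + p)) n
      ≡⟨ F-H (1 + p) ≤-refl n ⟩
    G δ n ℙ.+ shift M (G δ) n ℙ.+ shift (1 + p) (δ ⊞ shift 1 δ) n ℙ.+ shift (M + (p ∸ p)) (pascal q) n
      ≡⟨ cong₂ ℙ._+_ (cong₂ ℙ._+_ (cong (G δ n ℙ.+_) shifted) second) last ⟩
    (δ n ℙ.+ (a ℙ.+ (b ℙ.+ 0ℙ))) ℙ.+ (c ℙ.+ (e ℙ.+ d)) ℙ.+ (a ℙ.+ b) ℙ.+ (c ℙ.+ d)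
      ≡⟨ solve 6 (λ z a b c d e → (z :+ (a :+ (b :+ con 0ℙ))) :+ (c :+ (e :+ d)) :+ (a :+ b) :+ (c :+ d)
                                := z :+ e) refl (δ n) a b c d e ⟩
    δ n ℙ.+ e ∎
    where
    open ≡-Reasoning
    M = (1 + p) * q
    a = shift (1 + p) δ n
    b = shift q δ n
    c = shift M δ n
    d = shift M (shift q δ) n
    e = shift period δ n

    shifted : shift M (G δ) n ≡ c ℙ.+ (e ℙ.+ d)
    shifted
      rewrite shift-⊞ M δ (shift (1 + p) δ ⊞ (shift q δ ⊞ 𝟘)) n
            | shift-⊞ M (shift (1 + p) δ) (shift q δ ⊞ 𝟘) n
            | shift-⊞ M (shift q δ) 𝟘 n
            | shift-𝟘 M n
            | shift-shift M (1 + p) δ n = cong (λ u → c ℙ.+ (e ℙ.+ u)) (ℙ.+-identityʳ d)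

    second : shift (1 + p) (δ ⊞ shift 1 δ) n ≡ a ℙ.+ b
    second rewrite shift-⊞ (1 + p) δ (shift 1 δ) n | shift-shift (1 + p) 1 δ n | +-comm p 1 = refl

    last : shift (M + (p ∸ p)) (pascal q) n ≡ c ℙ.+ d
    last rewrite n∸n≡0 p | +-identityʳ M = trans (shift-cong M freshman n) (shift-⊞ M δ (shift q δ) n)

-- Pascal's triangle mod 2 and counting ones

-- The self-similarity of Pascal's triangle mod 2. The row j is kept general because doubling 2^r
-- applies the induction hypothesis at both 2^r + j and j; the middle terms then cancel.
pascal-+2^ : ∀ r j → pascal (2 ^ r + j) ≗ pascal j ⊞ shift (2 ^ r) (pascal j)
pascal-+2^ zero    j n = refl
pascal-+2^ (suc r) j n = begin
  pascal (2 ^ suc r + j) n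
    ≡⟨ cong (λ i → pascal i n) (trans (cong (λ i → Q + i + j) (+-identityʳ Q)) (+-assoc Q Q j)) ⟩
  pascal (Q + (Q + j)) n
    ≡⟨ pascal-+2^ r (Q + j) n ⟩
  pascal (Q + j) n ℙ.+ shift Q (pascal (Q + j)) n
    ≡⟨ cong₂ ℙ._+_ (pascal-+2^ r j n) (trans (shift-cong Q (pascal-+2^ r j) n)
         (trans (shift-⊞ Q (pascal j) (shift Q (pascal j)) n) (cong (shift Q (pascal j) n ℙ.+_) (shift-shift Q Q (pascal j) n)))) ⟩
  (pascal j n ℙ.+ shift Q (pascal j) n) ℙ.+ (shift Q (pascal j) n ℙ.+ shift (Q + Q) (pascal j) n)
    ≡⟨ solve 3 (λ u v w → (u :+ v) :+ (v :+ w) := u :+ w) refl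
         (pascal j n) (shift Q (pascal j) n) (shift (Q + Q) (pascal j) n) ⟩
  pascal j n ℙ.+ shift (Q + Q) (pascal j) n
    ≡⟨ cong (λ i → pascal j n ℙ.+ shift (Q + i) (pascal j) n) (+-identityʳ Q) ⟨
  pascal j n ℙ.+ shift (2 ^ suc r) (pascal j) n ∎
  where
  open ≡-Reasoning
  Q = 2 ^ r

pascal-2^ : ∀ r → pascal (2 ^ r) ≗ δ ⊞ shift (2 ^ r) δ
pascal-2^ r n = trans (cong (λ i → pascal i n) (sym (+-identityʳ (2 ^ r)))) (pascal-+2^ r 0 n)

ones-1ℙ : ∀ {m n} → n < m → ones m n ≡ 1ℙ
ones-1ℙ {suc m} {zero}  _         = refl
ones-1ℙ {suc m} {suc n} (s≤s n<m) = ones-1ℙ n<m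

-- Cancellation of factors with constant coefficient 1

shift-cong-< : ∀ m {a b} n → (∀ {i} → i < n → a i ≡ b i) → shift (suc m) a n ≡ shift (suc m) b n
shift-cong-< m       zero    eq = refl
shift-cong-< zero    (suc n) eq = eq ≤-refl
shift-cong-< (suc m) (suc n) eq = shift-cong-< m n (eq ∘ m≤n⇒m≤1+n)

mul-cong-< : ∀ ms {a b} n → (∀ {i} → i < n → a i ≡ b i) →
  mul (map suc ms) a n ≡ mul (map suc ms) b n
mul-cong-< []       n eq = refl
mul-cong-< (m ∷ ms) n eq = cong₂ ℙ._+_ (shift-cong-< m n eq) (mul-cong-< ms n eq)

-- Since 0 is an exponent and all the others are positive, coefficient n of the product is a n plus
-- a combination of earlier coefficients, so strong induction on n recovers a.
mul-injective : ∀ ms {a b} →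
  mul (0 ∷ map suc ms) a ≗ mul (0 ∷ map suc ms) b → a ≗ b
mul-injective ms {a} {b} eq = <-rec (λ n → a n ≡ b n) λ n rec →
  ℙ.+-cancelʳ-≡ (mul (map suc ms) a n) (a n) (b n)
    (trans (eq n) (cong (b n ℙ.+_) (sym (mul-cong-< ms n rec))))

⊞-shift-injective : ∀ m a b → a ⊞ shift (suc m) a ≗ b ⊞ shift (suc m) b → a ≗ b
⊞-shift-injective m a b eq = mul-injective (m ∷ []) λ n →
  trans (cong (a n ℙ.+_) (ℙ.+-identityʳ _))
    (trans (eq n) (cong (b n ℙ.+_) (sym (ℙ.+-identityʳ _))))

-- Degree bounds and numbers of ones

VanishesFrom : ℕ → Seq → Set
VanishesFrom m a = ∀ n → a (m + n) ≡ 0ℙ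

vanishes-≤ : ∀ {l m} a → l ≤ m → VanishesFrom l a → VanishesFrom m a
vanishes-≤ {l} {m} a l≤m v n = begin
  a (m + n)             ≡⟨ cong (λ i → a (i + n)) (m+[n∸m]≡n l≤m) ⟨
  a (l + (m ∸ l) + n)   ≡⟨ cong a (+-assoc l (m ∸ l) n) ⟩
  a (l + (m ∸ l + n))   ≡⟨ v (m ∸ l + n) ⟩
  0ℙ                    ∎
  where open ≡-Reasoning

vanishes-⊞ : ∀ m a b → VanishesFrom m a → VanishesFrom m b → VanishesFrom m (a ⊞ b)
vanishes-⊞ m a b va vb n = cong₂ ℙ._+_ (va n) (vb n)

vanishes-shift : ∀ l m a → VanishesFrom m a → VanishesFrom (l + m) (shift l a)
vanishes-shift l m a v n = begin
  shift l a (l + m + n)   ≡⟨ cong (shift l a) (+-assoc l m n) ⟩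
  shift l a (l + (m + n)) ≡⟨ shift-+ l a (m + n) ⟩
  a (m + n)               ≡⟨ v n ⟩
  0ℙ                      ∎
  where open ≡-Reasoning

ones-vanishes : ∀ m → VanishesFrom m (ones m)
ones-vanishes zero    n = refl
ones-vanishes (suc m) n = ones-vanishes m n

pascal-vanishes : ∀ j → VanishesFrom (suc j) (pascal j)
pascal-vanishes zero    n = refl
pascal-vanishes (suc j) n = vanishes-⊞ (2 + j) (pascal j) (shift 1 (pascal j))
  (vanishes-≤ (pascal j) (n≤1+n (suc j)) (pascal-vanishes j)) (pascal-vanishes j) n

bit : Parity → ℕ
bit 0ℙ = 0
bit 1ℙ = 1

sum< : ℕ → (ℕ → ℕ) → ℕ
sum< zero    f = 0
sum< (suc n) f = f 0 + sum< n (f ∘ suc)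

sum<-cong : ∀ n {f g} → (∀ {i} → i < n → f i ≡ g i) → sum< n f ≡ sum< n g
sum<-cong zero    eq = refl
sum<-cong (suc n) eq = cong₂ _+_ (eq z<s) (sum<-cong n (eq ∘ s<s))

sum<-+ : ∀ m n f → sum< (m + n) f ≡ sum< m f + sum< n (λ i → f (m + i))
sum<-+ zero    n f = refl
sum<-+ (suc m) n f = trans (cong (f 0 +_) (sum<-+ m n (f ∘ suc))) (sym (+-assoc (f 0) _ _))

sum<-last : ∀ n f → sum< (suc n) f ≡ sum< n f + f n
sum<-last zero    f = +-comm (f 0) 0
sum<-last (suc n) f = trans (cong (f 0 +_) (sum<-last n (f ∘ suc))) (sym (+-assoc (f 0) _ _))

sum<-* : ∀ c n f → sum< n (λ i → c * f i) ≡ c * sum< n f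
sum<-* c zero    f = sym (*-zeroʳ c)
sum<-* c (suc n) f = trans (cong (c * f 0 +_) (sum<-* c n (f ∘ suc))) (sym (*-distribˡ-+ c (f 0) _))

weight : ℕ → Seq → ℕ
weight n a = sum< n (bit ∘ a)

weight-cong : ∀ n {a b} → (∀ {i} → i < n → a i ≡ b i) → weight n a ≡ weight n b
weight-cong n eq = sum<-cong n (cong bit ∘ eq)

weight-𝟘 : ∀ n → weight n 𝟘 ≡ 0
weight-𝟘 zero    = refl
weight-𝟘 (suc n) = weight-𝟘 n

weight-vanishes : ∀ m n a → VanishesFrom m a → weight (m + n) a ≡ weight m a
weight-vanishes m n a v = begin
  weight (m + n) a                        ≡⟨ sum<-+ m n (bit ∘ a) ⟩
  weight m a + weight n (λ i → a (m + i)) ≡⟨ cong (weight m a +_) (weight-cong n (λ {i} _ → v i)) ⟩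
  weight m a + weight n 𝟘                 ≡⟨ cong (weight m a +_) (weight-𝟘 n) ⟩
  weight m a + 0                          ≡⟨ +-identityʳ _ ⟩
  weight m a                              ∎
  where open ≡-Reasoning

weight-vanishes-≤ : ∀ {m n} a → m ≤ n → VanishesFrom m a → weight n a ≡ weight m a
weight-vanishes-≤ {m} {n} a m≤n v =
  trans (cong (λ i → weight i a) (sym (m+[n∸m]≡n m≤n))) (weight-vanishes m (n ∸ m) a v)

weight-concat : ∀ m n a b → VanishesFrom m a →
  weight (m + n) (a ⊞ shift m b) ≡ weight m a + weight n b
weight-concat m n a b v = begin
  weight (m + n) (a ⊞ shift m b)
    ≡⟨ sum<-+ m n (bit ∘ (a ⊞ shift m b)) ⟩
  weight m (a ⊞ shift m b) + weight n (λ i → (a ⊞ shift m b) (m + i))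
    ≡⟨ cong₂ _+_
         (weight-cong m (λ {i} i<m → trans (cong (a i ℙ.+_) (shift-< b i<m)) (ℙ.+-identityʳ (a i))))
         (weight-cong n (λ {i} _ → cong₂ ℙ._+_ (v i) (shift-+ m b i))) ⟩
  weight m a + weight n b ∎
  where open ≡-Reasoning

weight-shift : ∀ m n b → weight (m + n) (shift m b) ≡ weight n b
weight-shift m n b = trans (weight-concat m n 𝟘 b (λ _ → refl)) (cong (_+ weight n b) (weight-𝟘 m))

weight-complement : ∀ n a b → (∀ {i} → i < n → a i ≡ 1ℙ) →
  weight n (a ⊞ b) + weight n b ≡ n
weight-complement zero    a b a≡1 = refl
weight-complement (suc n) a b a≡1 rewrite a≡1 {0} z<s = begin
  bit (1ℙ ℙ.+ b 0) + w′ + (bit (b 0) + w) ≡⟨ interchange (bit (1ℙ ℙ.+ b 0)) w′ (bit (b 0)) w ⟩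
  (bit (1ℙ ℙ.+ b 0) + bit (b 0)) + (w′ + w)
    ≡⟨ cong₂ _+_ (complement (b 0)) (weight-complement n (a ∘ suc) (b ∘ suc) (a≡1 ∘ s<s)) ⟩
  suc n ∎
  where
  open ≡-Reasoning
  w′ = weight n ((a ⊞ b) ∘ suc)
  w = weight n (b ∘ suc)
  interchange : ∀ i j k l → i + j + (k + l) ≡ (i + k) + (j + l)
  interchange = solve-∀
  complement : ∀ c → bit (1ℙ ℙ.+ c) + bit c ≡ 1
  complement 0ℙ = refl
  complement 1ℙ = refl

weight-ones : ∀ n → weight n (ones n) ≡ n
weight-ones n = begin
  weight n (ones n)                    ≡⟨ weight-cong n (λ {i} _ → ℙ.+-identityʳ (ones n i)) ⟨
  weight n (ones n ⊞ 𝟘)                ≡⟨ +-identityʳ _ ⟨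
  weight n (ones n ⊞ 𝟘) + 0            ≡⟨ cong (weight n (ones n ⊞ 𝟘) +_) (weight-𝟘 n) ⟨
  weight n (ones n ⊞ 𝟘) + weight n 𝟘   ≡⟨ weight-complement n (ones n) 𝟘 ones-1ℙ ⟩
  n                                    ∎
  where open ≡-Reasoning

-- Doubling the size triples the count: the lower rows stay within the first 2^r columns, and row
-- 2^r + j consists of two disjoint copies of row j.
weight-pascals : ∀ r → sum< (2 ^ r) (λ j → weight (2 ^ r) (pascal j)) ≡ 3 ^ r
weight-pascals zero    = refl
weight-pascals (suc r) = begin
  sum< (Q + (Q + 0)) (λ j → weight (Q + (Q + 0)) (pascal j))
    ≡⟨ cong (λ i → sum< (Q + i) (λ j → weight (Q + i) (pascal j))) (+-identityʳ Q) ⟩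
  sum< (Q + Q) (λ j → weight (Q + Q) (pascal j))
    ≡⟨ sum<-+ Q Q (λ j → weight (Q + Q) (pascal j)) ⟩
  sum< Q (λ j → weight (Q + Q) (pascal j)) + sum< Q (λ j → weight (Q + Q) (pascal (Q + j)))
    ≡⟨ cong₂ _+_ (sum<-cong Q (λ {j} j<Q → weight-vanishes Q Q (pascal j) (vanishes j<Q)))
                 (trans (sum<-cong Q upper) (sum<-* 2 Q (λ j → weight Q (pascal j)))) ⟩
  3 * sum< Q (λ j → weight Q (pascal j))
    ≡⟨ cong (3 *_) (weight-pascals r) ⟩
  3 ^ suc r ∎
  where
  open ≡-Reasoning
  Q = 2 ^ r
  vanishes : ∀ {j} → j < Q → VanishesFrom Q (pascal j)
  vanishes {j} j<Q = vanishes-≤ (pascal j) j<Q (pascal-vanishes j)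
  upper : ∀ {j} → j < Q → weight (Q + Q) (pascal (Q + j)) ≡ 2 * weight Q (pascal j)
  upper {j} j<Q = begin
    weight (Q + Q) (pascal (Q + j))                  ≡⟨ weight-cong (Q + Q) (λ {i} _ → pascal-+2^ r j i) ⟩
    weight (Q + Q) (pascal j ⊞ shift Q (pascal j))   ≡⟨ weight-concat Q Q (pascal j) (pascal j) (vanishes j<Q) ⟩
    weight Q (pascal j) + weight Q (pascal j)        ≡⟨ cong (weight Q (pascal j) +_) (+-identityʳ _) ⟨
    2 * weight Q (pascal j) ∎

-- The number of ones in `H`

module _ (p : ℕ) where
  private
    q = 2 + p

  block-vanishes : ∀ j → j ≤ 1 + p → VanishesFrom q (block p j)
  block-vanishes j j≤ = vanishes-⊞ q (ones q) (shift (1 + p ∸ j) (pascal j)) (ones-vanishes q)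
    (subst (λ m → VanishesFrom m (shift (1 + p ∸ j) (pascal j)))
       (trans (+-suc (1 + p ∸ j) j) (cong suc (m∸n+n≡m j≤)))
       (vanishes-shift (1 + p ∸ j) (suc j) (pascal j) (pascal-vanishes j)))

  H-vanishes : ∀ j → j ≤ 2 + p → VanishesFrom (j * q) (H p j)
  H-vanishes zero    _        n = refl
  H-vanishes (suc j) (s≤s j≤) n = vanishes-⊞ (q + j * q) (H p j) (shift (j * q) (block p j))
    (vanishes-≤ (H p j) (m≤n+m (j * q) q) (H-vanishes j (m≤n⇒m≤1+n j≤)))
    (subst (λ m → VanishesFrom m (shift (j * q) (block p j))) (+-comm (j * q) q)
      (vanishes-shift (j * q) q (block p j) (block-vanishes j j≤)))
    n

  weight-block : ∀ j → j ≤ 1 + p → weight q (block p j) + weight q (pascal j) ≡ q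
  weight-block j j≤ = begin
    weight q (block p j) + weight q (pascal j)
      ≡⟨ cong (weight q (block p j) +_) (weight-vanishes-≤ (pascal j) (s≤s j≤) (pascal-vanishes j)) ⟩
    weight q (block p j) + weight (suc j) (pascal j)
      ≡⟨ cong (weight q (block p j) +_) (weight-shift k (suc j) (pascal j)) ⟨
    weight q (block p j) + weight (k + suc j) (shift k (pascal j))
      ≡⟨ cong (λ m → weight q (block p j) + weight m (shift k (pascal j)))
           (trans (+-suc k j) (cong suc (m∸n+n≡m j≤))) ⟩
    weight q (block p j) + weight q (shift k (pascal j))
      ≡⟨ weight-complement q (ones q) (shift k (pascal j)) ones-1ℙ ⟩
    q ∎
    where
    open ≡-Reasoning
    k = 1 + p ∸ j

  weight-H : ∀ j → j ≤ 2 + p →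
    weight (j * q) (H p j) + sum< j (λ i → weight q (pascal i)) ≡ j * q
  weight-H zero    _        = refl
  weight-H (suc j) (s≤s j≤) = begin
    weight (q + j * q) (H p (suc j)) + sum< (suc j) R
      ≡⟨ cong₂ _+_ (trans (cong (λ m → weight m (H p (suc j))) (+-comm q (j * q)))
                     (weight-concat (j * q) q (H p j) (block p j) (H-vanishes j (m≤n⇒m≤1+n j≤))))
                   (sum<-last j R) ⟩
    weight (j * q) (H p j) + weight q (block p j) + (sum< j R + R j)
      ≡⟨ rearrange (weight (j * q) (H p j)) (weight q (block p j)) (sum< j R) (R j) ⟩
    (weight q (block p j) + R j) + (weight (j * q) (H p j) + sum< j R)
      ≡⟨ cong₂ _+_ (weight-block j j≤) (weight-H j (m≤n⇒m≤1+n j≤)) ⟩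
    q + j * q ∎
    where
    open ≡-Reasoning
    R = λ i → weight q (pascal i)
    rearrange : ∀ i j k l → i + j + (k + l) ≡ (j + l) + (i + k)
    rearrange = solve-∀

  -- `H` uses only the rows 0, ..., q - 2, while the count 3^r concerns all q rows. The missing row
  -- q - 1 consists of q ones, which raises the total (q - 1) q to q².
  weight-H-last : pascal q ≗ δ ⊞ shift q δ →
    weight (period p) (H p (1 + p)) + sum< q (λ j → weight q (pascal j)) ≡ q * q
  weight-H-last freshman = begin
    weight (period p) h + sum< q R
      ≡⟨ cong₂ _+_ (weight-vanishes M (1 + p) h (H-vanishes (1 + p) (n≤1+n _))) (sum<-last (1 + p) R) ⟩
    weight M h + (sum< (1 + p) R + R (1 + p))
      ≡⟨ +-assoc (weight M h) _ _ ⟨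
    weight M h + sum< (1 + p) R + R (1 + p)
      ≡⟨ cong₂ _+_ (weight-H (1 + p) (n≤1+n _)) last-row ⟩
    M + q
      ≡⟨ +-comm M q ⟩
    q * q ∎
    where
    open ≡-Reasoning
    h = H p (1 + p)
    M = (1 + p) * q
    R = λ i → weight q (pascal i)
    last-row : R (1 + p) ≡ q
    -- Both (1 + x)^(q-1) and 1 + ... + x^(q-1) become 1 + x^q when multiplied by 1 + x, so
    -- cancelling 1 + x identifies them.
    last-row = trans
      (weight-cong q {b = ones q} λ {i} _ → ⊞-shift-injective 0 (pascal (1 + p)) (ones q)
         (λ n → trans (freshman n) (sym (ones-telescope q n))) i)
      (weight-ones q)

-- Coefficients of polynomials

coeff-⊕ : ∀ g h → coeff (g ⊕ h) ≗ coeff g ⊞ coeff h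
coeff-⊕ []      h       n       = refl
coeff-⊕ (a ∷ g) []      n       = sym (ℙ.+-identityʳ _)
coeff-⊕ (a ∷ g) (b ∷ h) zero    = refl
coeff-⊕ (a ∷ g) (b ∷ h) (suc n) = coeff-⊕ g h n

coeff-x^ : ∀ m → coeff (x^ m) ≗ shift m δ
coeff-x^ zero    zero    = refl
coeff-x^ zero    (suc n) = refl
coeff-x^ (suc m) zero    = refl
coeff-x^ (suc m) (suc n) = coeff-x^ m n

coeff-1⊕x^ : ∀ m → coeff (1ₚ ⊕ x^ m) ≗ δ ⊞ shift m δ
coeff-1⊕x^ m n = trans (coeff-⊕ 1ₚ (x^ m) n) (cong₂ ℙ._+_ (coeff-x^ 0 n) (coeff-x^ m n))

coeff-map-* : ∀ a g n → coeff (map (a ℙ.*_) g) n ≡ a ℙ.* coeff g n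
coeff-map-* a []      n       = sym (ℙ.*-zeroʳ a)
coeff-map-* a (b ∷ g) zero    = refl
coeff-map-* a (b ∷ g) (suc n) = coeff-map-* a g n

coeff-0∷ : ∀ g → coeff (0ℙ ∷ g) ≗ shift 1 (coeff g)
coeff-0∷ g zero    = refl
coeff-0∷ g (suc n) = refl

coeff-∷-⊗ : ∀ a g h n → coeff ((a ∷ g) ⊗ h) n ≡ a ℙ.* coeff h n ℙ.+ shift 1 (coeff (g ⊗ h)) n
coeff-∷-⊗ a g h n = trans (coeff-⊕ (map (a ℙ.*_) h) (0ℙ ∷ (g ⊗ h)) n)
  (cong₂ ℙ._+_ (coeff-map-* a h n) (coeff-0∷ (g ⊗ h) n))

coeff-⊕-⊗ : ∀ f g h → coeff ((f ⊕ g) ⊗ h) ≗ coeff (f ⊗ h) ⊞ coeff (g ⊗ h)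
coeff-⊕-⊗ []      g       h n = refl
coeff-⊕-⊗ (a ∷ f) []      h n = sym (ℙ.+-identityʳ _)
coeff-⊕-⊗ (a ∷ f) (b ∷ g) h n = begin
  coeff ((a ℙ.+ b ∷ f ⊕ g) ⊗ h) n
    ≡⟨ coeff-∷-⊗ (a ℙ.+ b) (f ⊕ g) h n ⟩
  (a ℙ.+ b) ℙ.* coeff h n ℙ.+ shift 1 (coeff ((f ⊕ g) ⊗ h)) n
    ≡⟨ cong₂ ℙ._+_ (ℙ.*-distribʳ-+ (coeff h n) a b)
         (trans (shift-cong 1 (coeff-⊕-⊗ f g h) n) (shift-⊞ 1 (coeff (f ⊗ h)) (coeff (g ⊗ h)) n)) ⟩
  ((a ℙ.* coeff h n) ℙ.+ (b ℙ.* coeff h n)) ℙ.+ (shift 1 (coeff (f ⊗ h)) n ℙ.+ shift 1 (coeff (g ⊗ h)) n)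
    ≡⟨ solve 4 (λ u v w z → (u :+ v) :+ (w :+ z) := (u :+ w) :+ (v :+ z)) refl
         (a ℙ.* coeff h n) (b ℙ.* coeff h n) (shift 1 (coeff (f ⊗ h)) n) (shift 1 (coeff (g ⊗ h)) n) ⟩
  (a ℙ.* coeff h n ℙ.+ shift 1 (coeff (f ⊗ h)) n) ℙ.+ (b ℙ.* coeff h n ℙ.+ shift 1 (coeff (g ⊗ h)) n)
    ≡⟨ cong₂ ℙ._+_ (coeff-∷-⊗ a f h n) (coeff-∷-⊗ b g h n) ⟨
  (coeff ((a ∷ f) ⊗ h) ⊞ coeff ((b ∷ g) ⊗ h)) n ∎
  where open ≡-Reasoning

coeff-x^-⊗ : ∀ m h → coeff (x^ m ⊗ h) ≗ shift m (coeff h)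
coeff-x^-⊗ zero    h n = trans (coeff-∷-⊗ 1ℙ [] h n)
  (trans (cong (coeff h n ℙ.+_) (shift-𝟘 1 n)) (ℙ.+-identityʳ _))
coeff-x^-⊗ (suc m) h n = begin
  coeff (x^ (suc m) ⊗ h) n          ≡⟨ coeff-∷-⊗ 0ℙ (x^ m) h n ⟩
  shift 1 (coeff (x^ m ⊗ h)) n      ≡⟨ shift-cong 1 (coeff-x^-⊗ m h) n ⟩
  shift 1 (shift m (coeff h)) n     ≡⟨ shift-shift 1 m (coeff h) n ⟩
  shift (suc m) (coeff h) n         ∎
  where open ≡-Reasoning

coeff-vanishes : ∀ g → VanishesFrom (length g) (coeff g)
coeff-vanishes []      n = refl
coeff-vanishes (a ∷ g) n = coeff-vanishes g n

coeff-applyUpTo : ∀ a m → a ≗ coeff (applyUpTo a m) ⊞ shift m (λ n → a (m + n))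
coeff-applyUpTo a zero    n       = refl
coeff-applyUpTo a (suc m) zero    = sym (ℙ.+-identityʳ _)
coeff-applyUpTo a (suc m) (suc n) = coeff-applyUpTo (a ∘ suc) m n

ℓ₁-applyUpTo : ∀ a n → ℓ₁ (applyUpTo a n) ≡ weight n a
ℓ₁-applyUpTo a zero = refl
ℓ₁-applyUpTo a (suc n) with a 0
... | 0ℙ = ℓ₁-applyUpTo (a ∘ suc) n
... | 1ℙ = cong suc (ℓ₁-applyUpTo (a ∘ suc) n)

-- `upTo` is `applyUpTo id`, and the induction replaces `g` by `g ∘ suc`; keeping `a` separate
-- leaves the filter predicate unchanged.
zeros+weight : ∀ (a : Seq) g n →
  length (filter (λ k → a k ℙ.≟ 0ℙ) (applyUpTo g n)) + weight n (a ∘ g) ≡ n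
zeros+weight a g zero = refl
zeros+weight a g (suc n) with a (g 0)
... | 0ℙ = cong suc (zeros+weight a (g ∘ suc) n)
... | 1ℙ = trans (+-suc _ _) (cong suc (zeros+weight a (g ∘ suc) n))

ℓ₀+weight : ∀ n g → 1 ≤ n → ℓ₀ (n ∸ 1) g + weight n (coeff g) ≡ n
ℓ₀+weight (suc n) g _ = zeros+weight (coeff g) id (suc n)

-- Periods of sequences

module _ {P : Pred ℕ 0ℓ} (P? : Decidable P) where

  leastWitness : ∀ n → P n → ∃[ m ] (P m × (∀ k → P k → m ≤ k))
  leastWitness = <-rec (λ n → P n → ∃[ m ] (P m × (∀ k → P k → m ≤ k))) step
    where
    step : ∀ n → (∀ {m} → m < n → P m → ∃[ l ] (P l × (∀ k → P k → l ≤ k))) →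
           P n → ∃[ l ] (P l × (∀ k → P k → l ≤ k))
    step n rec Pn with anyUpTo? P? n
    ... | yes (m , m<n , Pm) = rec m<n Pm
    ... | no ∄               = n , Pn , λ k Pk → ≮⇒≥ λ k<n → ∄ (k , k<n , Pk)

Periodic : Seq → ℕ → Set
Periodic a E = ∀ n → a (E + n) ≡ a n

module _ {a : Seq} where

  periodic-* : ∀ {E} → Periodic a E → ∀ k → Periodic a (k * E)
  periodic-*     per zero    n = refl
  periodic-* {E} per (suc k) n =
    trans (cong a (+-assoc E (k * E) n)) (trans (per (k * E + n)) (periodic-* per k n))

  periodic-% : ∀ {N} E .{{_ : NonZero E}} → Periodic a E → Periodic a N → Periodic a (N % E)
  periodic-% {N} E perE perN n = begin
    a (N % E + n)               ≡⟨ periodic-* perE (N / E) (N % E + n) ⟨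
    a (N / E * E + (N % E + n)) ≡⟨ cong a (+-assoc (N / E * E) (N % E) n) ⟨
    a (N / E * E + N % E + n)   ≡⟨ cong (λ i → a (i + n)) (+-comm (N / E * E) (N % E)) ⟩
    a (N % E + N / E * E + n)   ≡⟨ cong (λ i → a (i + n)) (m≡m%n+[m/n]*n N E) ⟨
    a (N + n)                   ≡⟨ perN n ⟩
    a n                         ∎
    where open ≡-Reasoning

  -- A known period N reduces the infinitely many conditions to those with n < N, so the least
  -- period can be found by a finite search.
  periodic? : ∀ {N} .{{_ : NonZero N}} → Periodic a N → Decidable (Periodic a)
  periodic? {N} perN E = map′ extend (λ perE {n} _ → perE n)
    (allUpTo? (λ n → a (E + n) ℙ.≟ a n) N)
    where
    open ≡-Reasoning
    extend : (∀ {n} → n < N → a (E + n) ≡ a n) → Periodic a E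
    extend eq n = begin
      a (E + n)                     ≡⟨ cong (λ i → a (E + i)) (m≡m%n+[m/n]*n n N) ⟩
      a (E + (n % N + n / N * N))   ≡⟨ cong a (rotate E (n % N) (n / N * N)) ⟩
      a (n / N * N + (E + n % N))   ≡⟨ periodic-* perN (n / N) (E + n % N) ⟩
      a (E + n % N)                 ≡⟨ eq (m%n<n n N) ⟩
      a (n % N)                     ≡⟨ periodic-* perN (n / N) (n % N) ⟨
      a (n / N * N + n % N)         ≡⟨ cong a (+-comm (n / N * N) (n % N)) ⟩
      a (n % N + n / N * N)         ≡⟨ cong a (m≡m%n+[m/n]*n n N) ⟨
      a n                           ∎
      where
      rotate : ∀ i j k → i + (j + k) ≡ k + (i + j)
      rotate = solve-∀

  weight-periodic : ∀ {E} → Periodic a E → ∀ k → weight (k * E) a ≡ k * weight E a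
  weight-periodic     per zero    = refl
  weight-periodic {E} per (suc k) = begin
    weight (E + k * E) a                          ≡⟨ sum<-+ E (k * E) (bit ∘ a) ⟩
    weight E a + weight (k * E) (λ i → a (E + i)) ≡⟨ cong (weight E a +_) (weight-cong (k * E) (λ {i} _ → per i)) ⟩
    weight E a + weight (k * E) a                 ≡⟨ cong (weight E a +_) (weight-periodic per k) ⟩
    weight E a + k * weight E a                   ∎
    where open ≡-Reasoning

record LeastPeriod (a : Seq) (D : ℕ) : Set where
  field
    positive : 1 ≤ D
    periodic : Periodic a D
    least    : ∀ E → 1 ≤ E → Periodic a E → D ≤ E

leastPeriod : ∀ {a} N .{{_ : NonZero N}} → Periodic a N → ∃[ D ] LeastPeriod a D
leastPeriod {a} N perN
  with leastWitness (λ E → (1 ≤? E) ×-dec periodic? perN E) N (>-nonZero⁻¹ N , perN)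
... | D , (1≤D , perD) , least = D , record
  { positive = 1≤D ; periodic = perD ; least = λ E 1≤E perE → least E (1≤E , perE) }

LeastPeriod⇒∣ : ∀ {a D N} → LeastPeriod a D → Periodic a N → D ∣ N
LeastPeriod⇒∣ {a} {D@(suc _)} {N} lp perN with 1 ≤? N % D
... | yes 1≤N%D = contradiction (least (N % D) 1≤N%D (periodic-% D periodic perN)) (<⇒≱ (m%n<n N D))
  where open LeastPeriod lp
... | no 1≰N%D = m%n≡0⇒n∣m N D (n<1⇒n≡0 (≰⇒> 1≰N%D))
LeastPeriod⇒∣ {D = zero} lp _ with () ← LeastPeriod.positive lp

+≡0⇒≡ : ∀ c d → c ℙ.+ d ≡ 0ℙ → c ≡ d
+≡0⇒≡ 0ℙ 0ℙ _ = refl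
+≡0⇒≡ 1ℙ 1ℙ _ = refl

module _ (h : Seq) (N : ℕ) .{{_ : NonZero N}} where

  -- For h of degree below N this is the power series h / (1 + x^N).
  periodize : Seq
  periodize n = h (n % N)

  periodize-periodic : Periodic periodize N
  periodize-periodic n = cong h (trans (cong (_% N) (+-comm N n)) ([m+n]%n≡m%n n N))

  periodize-< : ∀ {n} → n < N → periodize n ≡ h n
  periodize-< n<N = cong h (m<n⇒m%n≡m n<N)

  periodize-⊞-shift : VanishesFrom N h → periodize ⊞ shift N periodize ≗ h
  periodize-⊞-shift h-vanishes n with n <? N
  ... | yes n<N = trans (cong₂ ℙ._+_ (periodize-< n<N) (shift-< periodize n<N)) (ℙ.+-identityʳ _)
  ... | no n≮N = subst (λ i → (periodize ⊞ shift N periodize) i ≡ h i) (m+[n∸m]≡n (≮⇒≥ n≮N)) (beyond (n ∸ N))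
    where
    beyond : ∀ k → (periodize ⊞ shift N periodize) (N + k) ≡ h (N + k)
    beyond k = begin
      periodize (N + k) ℙ.+ shift N periodize (N + k)
        ≡⟨ cong₂ ℙ._+_ (periodize-periodic k) (shift-+ N periodize k) ⟩
      periodize k ℙ.+ periodize k
        ≡⟨ ℙ.p+p≡0ℙ (periodize k) ⟩
      0ℙ
        ≡⟨ h-vanishes k ⟨
      h (N + k) ∎
      where open ≡-Reasoning

-- Multiples of f and periods of 1/f

module _ (p : ℕ) where

  -- The factor 1 + x^(1+N) can be cancelled from both sides; exponent 0 would make it zero, hence
  -- `suc N`.
  F-inverse : ∀ N a → F p (a ⊞ shift (suc N) a) ≗ δ ⊞ shift (suc N) δ → F p a ≗ δ
  F-inverse N a eq = ⊞-shift-injective N (F p a) δ λ n → begin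
    (F p a ⊞ shift (suc N) (F p a)) n        ≡⟨ cong (F p a n ℙ.+_) (mul-shift (F-exponents p) (suc N) a n) ⟨
    F p a n ℙ.+ F p (shift (suc N) a) n      ≡⟨ mul-⊞ (F-exponents p) a (shift (suc N) a) n ⟨
    F p (a ⊞ shift (suc N) a) n              ≡⟨ eq n ⟩
    (δ ⊞ shift (suc N) δ) n                  ∎
    where open ≡-Reasoning

  -- Compares degrees: the coefficients of c vanish from the top down, since the
  -- coefficient of x^(n + deg f) in f·c is c n plus higher coefficients of c.
  F-degree : ∀ {E L} c → F p c ≗ δ ⊞ shift E δ → VanishesFrom L c →
             ∀ n → E < 3 + p + n → c n ≡ 0ℙ
  F-degree {E} {L} c eq c-vanishes n = descend L n (m≤m+n L n)
    where
    open ≡-Reasoning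
    descend : ∀ d n → L ≤ d + n → E < 3 + p + n → c n ≡ 0ℙ
    descend zero    n L≤n _ = trans (cong c (sym (m+[n∸m]≡n L≤n))) (c-vanishes (n ∸ L))
    descend (suc d) n L≤  E< = begin
      c n
        ≡⟨ shift-+ (3 + p) c n ⟨
      shift (3 + p) c (3 + p + n)
        ≡⟨ ℙ.+-identityʳ _ ⟨
      shift (3 + p) c (3 + p + n) ℙ.+ 0ℙ
        ≡⟨ cong₂ ℙ._+_ (above (2 + p)) (cong₂ ℙ._+_ (above (1 + p))
             (cong (ℙ._+ (shift (3 + p) c (3 + p + n) ℙ.+ 0ℙ)) middle)) ⟨
      F p c (3 + p + n)
        ≡⟨ eq (3 + p + n) ⟩
      shift E δ (3 + p + n)
        ≡⟨ cong (shift E δ) (m+[n∸m]≡n E<) ⟨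
      shift E δ (suc E + (3 + p + n ∸ suc E))
        ≡⟨ cong (λ i → shift E δ (i + (3 + p + n ∸ suc E))) (+-comm E 1) ⟨
      shift E δ (E + 1 + (3 + p + n ∸ suc E))
        ≡⟨ vanishes-shift E 1 δ (λ _ → refl) (3 + p + n ∸ suc E) ⟩
      0ℙ ∎
      where
      above : ∀ k → c (suc k + n) ≡ 0ℙ
      above k = descend d (suc k + n)
        (≤-trans L≤ (≤-trans (≤-reflexive (sym (+-suc d n))) (+-monoʳ-≤ d (s≤s (m≤n+m n k)))))
        (≤-trans E< (+-monoʳ-≤ (3 + p) (m≤n+m n (suc k))))
      middle : shift (1 + p) c (3 + p + n) ≡ 0ℙ
      middle = begin
        shift (1 + p) c (3 + p + n)       ≡⟨ cong (shift (1 + p) c) (reassoc p n) ⟩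
        shift (1 + p) c (1 + p + (2 + n)) ≡⟨ shift-+ (1 + p) c (2 + n) ⟩
        c (2 + n)                         ≡⟨ above 1 ⟩
        0ℙ                                ∎
        where
        reassoc : ∀ i j → 3 + i + j ≡ 1 + i + (2 + j)
        reassoc = solve-∀

  -- For E below deg f = 3 + p, `F-degree` would force c 0 = 0, whereas E ≥ 1 makes the constant
  -- coefficient of f·c equal to 1.
  F-degree-≤ : ∀ {E L} c → F p c ≗ δ ⊞ shift E δ → VanishesFrom L c → 1 ≤ E → 3 + p ≤ E
  F-degree-≤ {E@(suc _)} {L} c eq c-vanishes _ = ≮⇒≥ λ E<3+p → contradiction
    (begin
      1ℙ        ≡⟨ eq 0 ⟨
      c 0 ℙ.+ 0ℙ ≡⟨ ℙ.+-identityʳ (c 0) ⟩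
      c 0        ≡⟨ F-degree c eq c-vanishes 0 (≤-trans E<3+p (m≤m+n (3 + p) 0)) ⟩
      0ℙ ∎)
    λ ()
    where open ≡-Reasoning

  module _ (s : Seq) (Fs≗δ : F p s ≗ δ) where

    -- Cancelling f gives c = s (1 + x^E). By `F-degree` c has no terms from exponent E on, which
    -- says that s and x^E s agree there.
    divides⇒periodic : ∀ {E L} c → F p c ≗ δ ⊞ shift E δ → VanishesFrom L c → Periodic s E
    divides⇒periodic {E} c eq c-vanishes n = +≡0⇒≡ (s (E + n)) (s n) (begin
      s (E + n) ℙ.+ s n                ≡⟨ cong (s (E + n) ℙ.+_) (shift-+ E s n) ⟨
      (s ⊞ shift E s) (E + n)          ≡⟨ c≗ (E + n) ⟨
      c (E + n)                        ≡⟨ F-degree c eq c-vanishes (E + n)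
                                            (s≤s (≤-trans (m≤m+n E n) (m≤n+m (E + n) (2 + p)))) ⟩
      0ℙ                               ∎)
      where
      open ≡-Reasoning
      c≗ : c ≗ s ⊞ shift E s
      -- The nonzero exponents of f, each lowered by one.
      c≗ = mul-injective (0 ∷ p ∷ 2 + p ∷ []) λ i → begin
        F p c i                                ≡⟨ eq i ⟩
        (δ ⊞ shift E δ) i                      ≡⟨ cong₂ ℙ._+_ (Fs≗δ i) (shift-cong E Fs≗δ i) ⟨
        (F p s ⊞ shift E (F p s)) i            ≡⟨ cong (F p s i ℙ.+_) (mul-shift (F-exponents p) E s i) ⟨
        F p s i ℙ.+ F p (shift E s) i          ≡⟨ mul-⊞ (F-exponents p) s (shift E s) i ⟨
        F p (s ⊞ shift E s) i                  ∎

    truncation : ∀ {E} → Periodic s E → s ≗ coeff (applyUpTo s E) ⊞ shift E s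
    truncation {E} per n =
      trans (coeff-applyUpTo s E n) (cong (coeff (applyUpTo s E) n ℙ.+_) (shift-cong E per n))

    -- Multiply s = c + x^E s by f, where c is the truncation of s below x^E and f·s = 1.
    periodic⇒divides : ∀ {E} → Periodic s E → F p (coeff (applyUpTo s E)) ≗ δ ⊞ shift E δ
    periodic⇒divides {E} per n = begin
      F p c n
        ≡⟨ solve 2 (λ u v → u := u :+ v :+ v) refl (F p c n) (shift E δ n) ⟩
      F p c n ℙ.+ shift E δ n ℙ.+ shift E δ n
        ≡⟨ cong (λ u → F p c n ℙ.+ u ℙ.+ shift E δ n)
             (trans (mul-shift (F-exponents p) E s n) (shift-cong E Fs≗δ n)) ⟨
      F p c n ℙ.+ F p (shift E s) n ℙ.+ shift E δ n
        ≡⟨ cong (ℙ._+ shift E δ n) (mul-⊞ (F-exponents p) c (shift E s) n) ⟨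
      F p (c ⊞ shift E s) n ℙ.+ shift E δ n
        ≡⟨ cong (ℙ._+ shift E δ n) (mul-cong (F-exponents p) (truncation per) n) ⟨
      F p s n ℙ.+ shift E δ n
        ≡⟨ cong (ℙ._+ shift E δ n) (Fs≗δ n) ⟩
      (δ ⊞ shift E δ) n ∎
      where
      open ≡-Reasoning
      c = coeff (applyUpTo s E)

-- The order and dual of f₁ r

coeff-f₁ : ∀ r {p} → 2 ^ r ≡ 2 + p → coeff (f₁ r) ≗ F p δ
coeff-f₁ r {p} eq n rewrite eq | +-comm p 1 = begin
  coeff (1ₚ ⊕ x^ 1 ⊕ x^ (1 + p) ⊕ x^ (3 + p)) n
    ≡⟨ coeff-⊕ (1ₚ ⊕ x^ 1 ⊕ x^ (1 + p)) (x^ (3 + p)) n ⟩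
  coeff (1ₚ ⊕ x^ 1 ⊕ x^ (1 + p)) n ℙ.+ coeff (x^ (3 + p)) n
    ≡⟨ cong (ℙ._+ coeff (x^ (3 + p)) n) (coeff-⊕ (1ₚ ⊕ x^ 1) (x^ (1 + p)) n) ⟩
  coeff (1ₚ ⊕ x^ 1) n ℙ.+ coeff (x^ (1 + p)) n ℙ.+ coeff (x^ (3 + p)) n
    ≡⟨ cong₂ ℙ._+_ (cong₂ ℙ._+_ (coeff-1⊕x^ 1 n) (coeff-x^ (1 + p) n)) (coeff-x^ (3 + p) n) ⟩
  δ n ℙ.+ shift 1 δ n ℙ.+ shift (1 + p) δ n ℙ.+ shift (3 + p) δ n
    ≡⟨ solve 4 (λ u v w z → u :+ v :+ w :+ z := u :+ (v :+ (w :+ (z :+ con 0ℙ)))) refl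
         (δ n) (shift 1 δ n) (shift (1 + p) δ n) (shift (3 + p) δ n) ⟩
  F p δ n ∎
  where open ≡-Reasoning

coeff-f₁-⊗ : ∀ r {p} → 2 ^ r ≡ 2 + p → ∀ g → coeff (f₁ r ⊗ g) ≗ F p (coeff g)
coeff-f₁-⊗ r {p} eq g n rewrite eq | +-comm p 1 = begin
  coeff ((1ₚ ⊕ x^ 1 ⊕ x^ (1 + p) ⊕ x^ (3 + p)) ⊗ g) n
    ≡⟨ coeff-⊕-⊗ (1ₚ ⊕ x^ 1 ⊕ x^ (1 + p)) (x^ (3 + p)) g n ⟩
  coeff ((1ₚ ⊕ x^ 1 ⊕ x^ (1 + p)) ⊗ g) n ℙ.+ coeff (x^ (3 + p) ⊗ g) n
    ≡⟨ cong (ℙ._+ coeff (x^ (3 + p) ⊗ g) n)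
         (trans (coeff-⊕-⊗ (1ₚ ⊕ x^ 1) (x^ (1 + p)) g n)
           (cong (ℙ._+ coeff (x^ (1 + p) ⊗ g) n) (coeff-⊕-⊗ 1ₚ (x^ 1) g n))) ⟩
  coeff (1ₚ ⊗ g) n ℙ.+ coeff (x^ 1 ⊗ g) n ℙ.+ coeff (x^ (1 + p) ⊗ g) n ℙ.+ coeff (x^ (3 + p) ⊗ g) n
    ≡⟨ cong₂ ℙ._+_ (cong₂ ℙ._+_ (cong₂ ℙ._+_ (coeff-x^-⊗ 0 g n) (coeff-x^-⊗ 1 g n))
         (coeff-x^-⊗ (1 + p) g n)) (coeff-x^-⊗ (3 + p) g n) ⟩
  a n ℙ.+ shift 1 a n ℙ.+ shift (1 + p) a n ℙ.+ shift (3 + p) a n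
    ≡⟨ solve 4 (λ u v w z → u :+ v :+ w :+ z := u :+ (v :+ (w :+ (z :+ con 0ℙ)))) refl
         (a n) (shift 1 a n) (shift (1 + p) a n) (shift (3 + p) a n) ⟩
  F p a n ∎
  where
  open ≡-Reasoning
  a = coeff g

4^≡2^*2^ : ∀ r → 4 ^ r ≡ 2 ^ r * 2 ^ r
4^≡2^*2^ r = begin
  (2 ^ 2) ^ r      ≡⟨ ^-*-assoc 2 2 r ⟩
  2 ^ (2 * r)      ≡⟨ cong (λ i → 2 ^ (r + i)) (+-identityʳ r) ⟩
  2 ^ (r + r)      ≡⟨ ^-distribˡ-+-* 2 r r ⟩
  2 ^ r * 2 ^ r    ∎
  where open ≡-Reasoning

-- As the order is not known explicitly, the counts are recorded after multiplication by (4^r - 1) /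
-- ord, with 1 and 3^r moved across to avoid truncated subtraction.
record DualCount (r : ℕ) : Set where
  field
    dual : Dual (f₁ r)
  open Dual dual public
  field
    copies       : ℕ
    copies*ord   : 1 + copies * ord ≡ 4 ^ r
    copies*ℓ₁    : copies * ℓ₁ f* + 3 ^ r ≡ 4 ^ r
    2^r<ord      : 2 ^ r < ord
    ℓ₀+ℓ₁        : ℓ₀ (ord ∸ 1) f* + ℓ₁ f* ≡ ord

module _ (r p : ℕ) (2^r≡q : 2 ^ r ≡ 2 + p) where

  private
    q = 2 + p
    f = f₁ r

  f₁-divides : ∀ E g → f ⊗ g ≈ 1ₚ ⊕ x^ E → F p (coeff g) ≗ δ ⊞ shift E δ
  f₁-divides E g eq n =
    trans (sym (coeff-f₁-⊗ r 2^r≡q g n)) (trans (eq n) (coeff-1⊕x^ E n))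

  4^r≡1+period : 4 ^ r ≡ 1 + period p
  4^r≡1+period = begin
    4 ^ r                       ≡⟨ 4^≡2^*2^ r ⟩
    2 ^ r * 2 ^ r               ≡⟨ cong₂ _*_ 2^r≡q 2^r≡q ⟩
    q + (1 + p) * q             ≡⟨ +-comm q ((1 + p) * q) ⟩
    (1 + p) * q + q             ≡⟨ +-suc ((1 + p) * q) (1 + p) ⟩
    1 + period p                ∎
    where open ≡-Reasoning

  module _ (s : Seq) (Fs≗δ : F p s ≗ δ) {D : ℕ} (lp : LeastPeriod s D) where

    open LeastPeriod lp

    private
      g = applyUpTo s D

    f₁⊗truncation : f ⊗ g ≈ 1ₚ ⊕ x^ D
    f₁⊗truncation n = trans (coeff-f₁-⊗ r 2^r≡q g n)
      (trans (periodic⇒divides p s Fs≗δ periodic n) (sym (coeff-1⊕x^ D n)))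

    isOrder-LeastPeriod : IsOrder f D
    isOrder-LeastPeriod = record
      { f[0]≡1  = coeff-f₁ r 2^r≡q 0
      ; deg≥1   = 3 + p , s≤s z≤n , trans (coeff-f₁ r 2^r≡q (3 + p)) leading
      ; D≥1     = positive
      ; divides = g , f₁⊗truncation
      ; least   = λ E 1≤E (k , f⊗k≈) → least E 1≤E
          (divides⇒periodic p s Fs≗δ (coeff k) (f₁-divides E k f⊗k≈) (coeff-vanishes k))
      }
      where
      leading : F p δ (3 + p) ≡ 1ℙ
      leading = cong₂ ℙ._+_
        (trans (cong (shift (1 + p) δ) (trans (+-comm 3 p) (+-suc p 2))) (shift-+ (1 + p) δ 2))
        (cong (ℙ._+ 0ℙ) (trans (cong (shift (3 + p) δ) (sym (+-identityʳ (3 + p)))) (shift-+ (3 + p) δ 0)))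

    dualCount-LeastPeriod : D ∣ period p → weight (period p) s + 3 ^ r ≡ 4 ^ r → DualCount r
    dualCount-LeastPeriod (divides m N≡m*D) weight-s = record
      { dual = record { ord = D ; isOrder = isOrder-LeastPeriod ; f* = g ; f⊗f* = f₁⊗truncation }
      ; copies = m
      ; copies*ord = trans (cong suc (sym N≡m*D)) (sym 4^r≡1+period)
      ; copies*ℓ₁ = trans (cong (_+ 3 ^ r) m*ℓ₁≡weight) weight-s
      -- The strict bound q < D unfolds to 3 + p ≤ D, the comparison with deg f.
      ; 2^r<ord = subst (_< D) (sym 2^r≡q)
          (F-degree-≤ p (coeff g) (f₁-divides D g f₁⊗truncation) (coeff-vanishes g) positive)
      ; ℓ₀+ℓ₁ = trans (cong (λ i → ℓ₀ (D ∸ 1) g + i) (trans (ℓ₁-applyUpTo s D) (weight-cong D agrees)))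
                  (ℓ₀+weight D g positive)
      }
      where
      m*ℓ₁≡weight : m * ℓ₁ g ≡ weight (period p) s
      m*ℓ₁≡weight = begin
        m * ℓ₁ g            ≡⟨ cong (m *_) (ℓ₁-applyUpTo s D) ⟩
        m * weight D s      ≡⟨ weight-periodic periodic m ⟨
        weight (m * D) s    ≡⟨ cong (λ n → weight n s) N≡m*D ⟨
        weight (period p) s ∎
        where open ≡-Reasoning

      agrees : ∀ {i} → i < D → s i ≡ coeff g i
      agrees {i} i<D = trans (truncation p s Fs≗δ periodic i)
        (trans (cong (coeff g i ℙ.+_) (shift-< s i<D)) (ℙ.+-identityʳ _))

  dualCount : DualCount r
  dualCount = dualCount-LeastPeriod s Fs≗δ (proj₂ lp) (LeastPeriod⇒∣ (proj₂ lp) s-periodic) weight-s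
    where
    N = period p
    h = H p (1 + p)

    freshman-q : pascal q ≗ δ ⊞ shift q δ
    freshman-q = subst (λ m → pascal m ≗ δ ⊞ shift m δ) 2^r≡q (pascal-2^ r)

    h-vanishes : VanishesFrom N h
    h-vanishes = vanishes-≤ h (m≤m+n ((1 + p) * q) (1 + p)) (H-vanishes p (1 + p) (n≤1+n _))

    s : Seq
    -- The series `H` / (1 + x^N), which `Fs≗δ` identifies as 1/f.
    s = periodize h N

    Fs≗δ : F p s ≗ δ
    -- `period p` computes to a successor, so `suc (pred N)` is N by computation.
    Fs≗δ = F-inverse p (pred N) s λ n →
      trans (mul-cong (F-exponents p) (periodize-⊞-shift h N h-vanishes) n) (F-H-last p freshman-q n)

    s-periodic : Periodic s N
    s-periodic = periodize-periodic h N

    lp : ∃[ D ] LeastPeriod s D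
    lp = leastPeriod N s-periodic

    sum≡3^r : sum< q (λ j → weight q (pascal j)) ≡ 3 ^ r
    sum≡3^r = subst (λ n → sum< n (λ j → weight n (pascal j)) ≡ 3 ^ r) 2^r≡q (weight-pascals r)

    weight-s : weight N s + 3 ^ r ≡ 4 ^ r
    weight-s = begin
      weight N s + 3 ^ r
        ≡⟨ cong₂ _+_ (weight-cong N (periodize-< h N)) (sym sum≡3^r) ⟩
      weight N h + sum< q (λ j → weight q (pascal j))
        ≡⟨ weight-H-last p freshman-q ⟩
      q * q
        ≡⟨ cong₂ _*_ 2^r≡q 2^r≡q ⟨
      2 ^ r * 2 ^ r
        ≡⟨ 4^≡2^*2^ r ⟨
      4 ^ r ∎
      where open ≡-Reasoning

dualCounts : ∀ r → 1 ≤ r → DualCount r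
dualCounts r 1≤r = dualCount r (2 ^ r ∸ 2) (sym (m+[n∸m]≡n (^-monoʳ-≤ 2 1≤r)))

-- Robustness and the limit

2*3^r+2^r≤4^r : ∀ r → 3 ≤ r → 3 ^ r + 2 ^ r + 3 ^ r ≤ 4 ^ r
2*3^r+2^r≤4^r r 3≤r = subst (λ i → 3 ^ i + 2 ^ i + 3 ^ i ≤ 4 ^ i) (m+[n∸m]≡n 3≤r) (go (r ∸ 3))
  where
  open ≤-Reasoning
  go : ∀ k → 3 ^ (3 + k) + 2 ^ (3 + k) + 3 ^ (3 + k) ≤ 4 ^ (3 + k)
  -- 27 + 8 + 27 = 62 and 4^3 = 64.
  go zero    = m≤m+n 62 2
  go (suc k) = begin
    3 * t + 2 * u + 3 * t               ≤⟨ m≤m+n _ (2 * t + 2 * u) ⟩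
    3 * t + 2 * u + 3 * t + (2 * t + 2 * u) ≡⟨ collect t u ⟩
    4 * (t + u + t)                     ≤⟨ *-monoʳ-≤ 4 (go k) ⟩
    4 ^ (4 + k)                         ∎
    where
    t = 3 ^ (3 + k)
    u = 2 ^ (3 + k)
    collect : ∀ t u → 3 * t + 2 * u + 3 * t + (2 * t + 2 * u) ≡ 4 * (t + u + t)
    collect = solve-∀

-- Bernoulli's inequality (4/3)^r ≥ 1 + r/3 with denominators cleared.
[r+3]*3^r≤3*4^r : ∀ r → (r + 3) * 3 ^ r ≤ 3 * 4 ^ r
[r+3]*3^r≤3*4^r zero    = ≤-refl
[r+3]*3^r≤3*4^r (suc r) = begin
  (1 + r + 3) * (3 * t)          ≤⟨ m≤m+n _ (r * t) ⟩
  (1 + r + 3) * (3 * t) + r * t  ≡⟨ collect r t ⟩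
  4 * ((r + 3) * t)              ≤⟨ *-monoʳ-≤ 4 ([r+3]*3^r≤3*4^r r) ⟩
  4 * (3 * 4 ^ r)                ≡⟨ swap (4 ^ r) ⟩
  3 * (4 * 4 ^ r)                ∎
  where
  open ≤-Reasoning
  t = 3 ^ r
  collect : ∀ r t → (1 + r + 3) * (3 * t) + r * t ≡ 4 * ((r + 3) * t)
  collect = solve-∀
  swap : ∀ v → 4 * (3 * v) ≡ 3 * (4 * v)
  swap = solve-∀

module _ {r : ℕ} (d : DualCount r) where
  open DualCount d
  open ≤-Reasoning

  -- Among 4^r - 1 coefficients with 4^r - 3^r ones there remain 3^r - 1 zeros.
  copies*ℓ₀ : 1 + copies * ℓ₀ (ord ∸ 1) f* ≡ 3 ^ r
  copies*ℓ₀ = +-cancelʳ-≡ (copies * c) (1 + copies * z) (3 ^ r) (begin-equality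
    1 + copies * z + copies * c ≡⟨ cong suc (*-distribˡ-+ copies z c) ⟨
    1 + copies * (z + c)        ≡⟨ cong (λ n → 1 + copies * n) ℓ₀+ℓ₁ ⟩
    1 + copies * ord            ≡⟨ copies*ord ⟩
    4 ^ r                       ≡⟨ copies*ℓ₁ ⟨
    copies * c + 3 ^ r          ≡⟨ +-comm (copies * c) (3 ^ r) ⟩
    3 ^ r + copies * c          ∎)
    where
    z = ℓ₀ (ord ∸ 1) f*
    c = ℓ₁ f*

  copies<2^r : copies < 2 ^ r
  copies<2^r = *-cancelʳ-< (2 ^ r) copies (2 ^ r) (begin-strict
    copies * 2 ^ r ≤⟨ *-monoʳ-≤ copies (<⇒≤ 2^r<ord) ⟩
    copies * ord   <⟨ ≤-reflexive copies*ord ⟩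
    4 ^ r          ≡⟨ 4^≡2^*2^ r ⟩
    2 ^ r * 2 ^ r  ∎)

  robust : 3 ≤ r → Robust (f₁ r)
  -- Scaled by `copies` = m, the claim becomes (3^r - 1) + m < 4^r - 3^r, which m < 2^r reduces to
  -- the inequality `2*3^r+2^r≤4^r`.
  robust 3≤r = dual , *-cancelˡ-< copies (z + 1) c (+-cancelʳ-< (3 ^ r) _ _ (begin-strict
    copies * (z + 1) + 3 ^ r      ≡⟨ rearrange copies z (3 ^ r) ⟩
    copies * z + copies + 3 ^ r   <⟨ ≤-reflexive (cong (λ i → i + copies + 3 ^ r) copies*ℓ₀) ⟩
    3 ^ r + copies + 3 ^ r        ≤⟨ +-monoˡ-≤ (3 ^ r) (+-monoʳ-≤ (3 ^ r) (<⇒≤ copies<2^r)) ⟩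
    3 ^ r + 2 ^ r + 3 ^ r         ≤⟨ 2*3^r+2^r≤4^r r 3≤r ⟩
    4 ^ r                         ≡⟨ copies*ℓ₁ ⟨
    copies * c + 3 ^ r            ∎))
    where
    z = ℓ₀ (ord ∸ 1) f*
    c = ℓ₁ f*
    rearrange : ∀ k z t → k * (z + 1) + t ≡ k * z + k + t
    rearrange = solve-∀

  ord∣4^r-1 : ord ∣ 4 ^ r ∸ 1
  ord∣4^r-1 = divides copies (cong (_∸ 1) (sym copies*ord))

  -- The proportion of zeros is (3^r - 1) / (4^r - 1). From 3 (b + 1) ≤ r + 3 and Bernoulli's
  -- inequality, (b + 1) 3^r ≤ 4^r, so this proportion is below 1/b.
  ℓ₀-small : ∀ b → 1 ≤ b → 3 * b ≤ r → ℓ₀ (ord ∸ 1) f* * b < ord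
  ℓ₀-small b 1≤b 3b≤r = *-cancelˡ-< copies (z * b) ord (+-cancelˡ-< 1 _ _ (begin-strict
    1 + copies * (z * b)
      <⟨ +-monoʳ-≤ 1 (+-monoˡ-≤ (copies * (z * b)) 1≤b) ⟩
    1 + (b + copies * (z * b))
      ≤⟨ m≤m+n _ (copies * z) ⟩
    1 + (b + copies * (z * b)) + copies * z
      ≡⟨ factor copies z b ⟩
    suc b * (1 + copies * z)
      ≡⟨ cong (suc b *_) copies*ℓ₀ ⟩
    suc b * 3 ^ r
      ≤⟨ *-cancelˡ-≤ 3 (begin
           3 * (suc b * 3 ^ r) ≡⟨ *-assoc 3 (suc b) (3 ^ r) ⟨
           3 * suc b * 3 ^ r   ≤⟨ *-monoˡ-≤ (3 ^ r) (begin
             3 * suc b ≡⟨ *-suc 3 b ⟩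
             3 + 3 * b ≤⟨ +-monoʳ-≤ 3 3b≤r ⟩
             3 + r     ≡⟨ +-comm 3 r ⟩
             r + 3     ∎) ⟩
           (r + 3) * 3 ^ r     ≤⟨ [r+3]*3^r≤3*4^r r ⟩
           3 * 4 ^ r           ∎) ⟩
    4 ^ r
      ≡⟨ copies*ord ⟨
    1 + copies * ord ∎))
    where
    z = ℓ₀ (ord ∸ 1) f*
    factor : ∀ k z b → 1 + (b + k * (z * b)) + k * z ≡ suc b * (1 + k * z)
    factor = solve-∀

-- The distance from c/n to 1 is z/n, and a positive rational is at least the reciprocal of its
-- denominator.
∣c/n-1∣<ε : ∀ c z n .{{_ : NonZero n}} → z + c ≡ n →
  ∀ ε → 0ℚ ℚ.< ε → z * ℚ.denominatorℕ ε < n → ℚ.∣ pos c ℚ./ n ℚ.- 1ℚ ∣ ℚ.< ε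
∣c/n-1∣<ε c z n@(suc n-1) z+c≡n (mkℚ (pos zero) b _) (ℚ.*<* (+<+ ())) _
∣c/n-1∣<ε c z n@(suc n-1) z+c≡n ε@(mkℚ +[1+ a ] b _) 0<ε zb<n =
  ℚ.toℚᵘ-cancel-< (ℚᵘ.<-respˡ-≃ (ℚᵘ.≃-sym unnormalised) (ℚᵘ.*<* numerators))
  where
  -- The numerator of c/n - 1 in the form produced by unnormalised addition, with 1 having
  -- denominator 1.
  distance : ℤ.∣ pos c ℤ.* pos 1 ℤ.+ -[1+ 0 ] ℤ.* pos n ∣ ≡ z
  distance = begin
    ℤ.∣ pos c ℤ.* pos 1 ℤ.+ -[1+ 0 ] ℤ.* pos n ∣
      ≡⟨ cong₂ (λ i j → ℤ.∣ i ℤ.+ j ∣) (ℤ.*-identityʳ (pos c)) (ℤ.-1*i≡-i (pos n)) ⟩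
    ℤ.∣ pos c ℤ.- pos n ∣
      ≡⟨ cong ℤ.∣_∣ (ℤ.m-n≡m⊖n c n) ⟩
    ℤ.∣ c ℤ.⊖ n ∣
      ≡⟨ ℤ.∣⊖∣-≤ (subst (c ≤_) z+c≡n (m≤n+m c z)) ⟩
    n ∸ c
      ≡⟨ cong (_∸ c) z+c≡n ⟨
    z + c ∸ c
      ≡⟨ m+n∸n≡m z c ⟩
    z ∎
    where open ≡-Reasoning

  numerators : pos ℤ.∣ pos c ℤ.* pos 1 ℤ.+ -[1+ 0 ] ℤ.* pos n ∣ ℤ.* pos (suc b)
               ℤ.< +[1+ a ] ℤ.* pos (n * 1)
  numerators = begin-strict
    pos ℤ.∣ pos c ℤ.* pos 1 ℤ.+ -[1+ 0 ] ℤ.* pos n ∣ ℤ.* pos (suc b)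
      ≡⟨ cong (λ i → pos i ℤ.* pos (suc b)) distance ⟩
    pos z ℤ.* pos (suc b)
      ≡⟨ ℤ.pos-* z (suc b) ⟨
    pos (z * suc b)
      <⟨ +<+ (<-≤-trans zb<n (m≤n*m n (suc a))) ⟩
    pos (suc a * n)
      ≡⟨ cong (λ i → pos (suc a * i)) (*-identityʳ n) ⟨
    pos (suc a * (n * 1))
      ≡⟨ ℤ.pos-* (suc a) (n * 1) ⟩
    +[1+ a ] ℤ.* pos (n * 1) ∎
    where open ℤ.≤-Reasoning

  unnormalised : toℚᵘ ℚ.∣ pos c ℚ./ n ℚ.- 1ℚ ∣ ℚᵘ.≃ ℚᵘ.∣ mkℚᵘ (pos c) n-1 ℚᵘ.- 1ℚᵘ ∣
  unnormalised = ℚᵘ.≃-trans (ℚ.toℚᵘ-homo-∣-∣ (pos c ℚ./ n ℚ.- 1ℚ))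
    (ℚᵘ.∣-∣-cong (ℚᵘ.≃-trans (ℚ.toℚᵘ-homo-+ (pos c ℚ./ n) (ℚ.- 1ℚ))
      (ℚᵘ.+-congˡ (ℚᵘ.- 1ℚᵘ) (ℚ.toℚᵘ-fromℚᵘ (mkℚᵘ (pos c) n-1)))))

γ₁ : ℕ → ℚ
γ₁ r with 1 ≤? r
... | yes 1≤r = DualCount.γ (dualCounts r 1≤r)
-- A default value at r = 0, which lies below the threshold in `γ₁⟶1`.
... | no  _   = 0ℚ

γ₁-isGamma : ∀ r → 1 ≤ r → IsGamma (f₁ r) (γ₁ r)
γ₁-isGamma r 1≤r with 1 ≤? r
... | yes 1≤r′ = DualCount.dual (dualCounts r 1≤r′) , refl
... | no  1≰r  = contradiction 1≤r 1≰r

γ₁⟶1 : γ₁ ⟶ 1ℚ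
-- The threshold is the one at which `ℓ₀-small` brings the proportion of zeros below 1/b.
γ₁⟶1 ε 0<ε = 3 * b , close
  where
  b = ℚ.denominatorℕ ε

  close : ∀ r → 3 * b ≤ r → ℚ.∣ γ₁ r ℚ.- 1ℚ ∣ ℚ.< ε
  close r 3b≤r with 1 ≤? r
  ... | no 1≰r   = contradiction (≤-trans (s≤s z≤n) 3b≤r) 1≰r
  ... | yes 1≤r  = ∣c/n-1∣<ε (ℓ₁ f*) (ℓ₀ (ord ∸ 1) f*) ord {{>-nonZero (IsOrder.D≥1 isOrder)}} ℓ₀+ℓ₁ ε 0<ε
                     (ℓ₀-small d b (s≤s z≤n) 3b≤r)
    where
    d = dualCounts r 1≤r
    open DualCount d

mainTheorem1 : (∀ (r : ℕ) → 3 ≤ r →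
    Robust (f₁ r) × (∃[ D ] (IsOrder (f₁ r) D × D ∣ (4 ^ r ∸ 1))))
    × (Σ[ γ ∈ (ℕ → ℚ) ]
    ((∀ (r : ℕ) → 3 ≤ r → IsGamma (f₁ r) (γ r)) × (γ ⟶ 1ℚ)))
mainTheorem1 =
    (λ r 3≤r → let d = dualCounts r (1≤ 3≤r) in
       robust d 3≤r , DualCount.ord d , DualCount.isOrder d , ord∣4^r-1 d)
  , γ₁ , (λ r 3≤r → γ₁-isGamma r (1≤ 3≤r)) , γ₁⟶1
  where
  1≤ : ∀ {r} → 3 ≤ r → 1 ≤ r
  1≤ = ≤-trans (s≤s z≤n)
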